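{- Let $n,b$ be integers with $1<n<b$, and let $\Gamma$ be the $(n,b)$-Hoey-Sloane graph. If $(c_1,c_2)$ is an edge of $\Gamma$ with edge label $(d_1,d_2)$, then $(n-1-c_1,\,n-1-c_2)$ is also an edge of $\Gamma$, and $(b-1-d_1,\,b-1-d_2)$ is one of its edge labels.
   Context: Let $\lambda(x)$ denote the least non-negative residue of $x$ modulo $b$. The $(n,b)$-mother graph $M$ is the directed graph on vertex set $\{0,\ldots,b-1\}$ whose edges are the ordered pairs of digits $(d_1,d_2)$ with $\lambda(d_1+(b-n)d_2)\le n-1$. The $(n,b)$-Hoey-Sloane graph $\Gamma$ is the edge-labelled directed graph with vertex set (states) $\{0,1,\ldots,n-1\}$ in which, for states $c_1,c_2$, the pair $(c_1,c_2)$ is an edge precisely when the set $\{(d_1,d_2)\text{ an edge of }M \mid n d_2-d_1+c_1=b\,c_2\}$ is nonempty; this set is the collection of edge labels of $(c_1,c_2)$. (An input $(d_1,d_2)$ thus encodes one step of multiplying a number by $n$ in base $b$: multiplicand digit $d_2$, incoming carry $c_1$, product digit $d_1$, outgoing carry $c_2$.) -}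

module Defs where

open import Data.Fin.Base using (Fin; toℕ)
open import Data.Integer.Base using (ℤ; +_; 1ℤ; _+_; _-_; _*_; _≤_; _%ℕ_)
open import Data.Nat.Base using (ℕ; NonZero)
open import Data.Product.Base using (_×_; _,_)
open import Level using (0ℓ)
open import Relation.Binary.Core using (Rel)
open import Relation.Binary.PropositionalEquality.Core using (_≡_)
open import Relation.Unary using (Pred; Satisfiable)

-- A directed graph (loops allowed) on a vertex set V is given by its
-- edge relation on V.

module _ (n b : ℕ) .{{_ : NonZero b}} where

  Digit State : Set
  Digit = Fin b
  State = Fin n

  -- For an integer x, x %ℕ b is the least non-negative residue even when
  -- x is negative.
  residue : ℤ → ℤ
  residue x = + (x %ℕ b)

  MotherEdge : Rel Digit 0ℓ
  MotherEdge d₁ d₂ =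
    residue (+ toℕ d₁ + (+ b - + n) * + toℕ d₂) ≤ + n - 1ℤ

  EdgeLabels : State → State → Pred (Digit × Digit) 0ℓ
  EdgeLabels c₁ c₂ (d₁ , d₂) =
    MotherEdge d₁ d₂ ×
    + n * + toℕ d₂ - + toℕ d₁ + + toℕ c₁ ≡ + b * + toℕ c₂

  HoeySloaneEdge : Rel State 0ℓ
  HoeySloaneEdge c₁ c₂ = Satisfiable (EdgeLabels c₁ c₂)

{-# OPTIONS --safe #-}

-- Substituting the reflected digits and carries into n d₂ - d₁ + c₁ = b c₂
-- gives the same equation back. That equation also rewrites d₁ + (b - n) d₂ as
-- c₁ + b (d₂ - c₂), whose residue is at most c₁ ≤ n - 1, so it already forces
-- (d₁ , d₂) to be an edge of the mother graph.

module Submission where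

open import Defs
open import Data.Nat.Base using (ℕ; suc; NonZero; _<_; _∸_)
open import Data.Fin.Base using (Fin; opposite; toℕ)
open import Data.Product.Base using (_×_; _,_)
open import Relation.Unary using (_∈_)
open import Data.Fin.Properties using (opposite-prop; toℕ<n)
open import Data.Integer.Base as ℤ
  using (+_; 1ℤ; _+_; _-_; _*_; _≤_; _%ℕ_; _/ℕ_; +<+)
open import Data.Integer.DivMod using (a≡a%ℕn+[a/ℕn]*n; n<s[n/ℕd]*d)
open import Data.Integer.Properties
open import Data.Integer.Tactic.RingSolver using (solve-∀)
open import Relation.Binary.PropositionalEquality
  using (_≡_; trans; cong; cong₂; module ≡-Reasoning)

-- As `c` is non-negative, `x = c + k * d` is at least `k * d`, so its floor quotient `q` is at
-- least `k`. The residue `x - q * d` is then at most `x - k * d = c`.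
[c+k*d]%ℕd≤c : ∀ c k d .{{_ : NonZero d}} → + ((+ c + k * + d) %ℕ d) ≤ + c
[c+k*d]%ℕd≤c c k d@(suc _) = begin
  + (x %ℕ d)                      ≡⟨ add-sub (+ (x %ℕ d)) (q * + d) ⟩
  + (x %ℕ d) + q * + d - q * + d  ≡⟨ cong (_- q * + d) (a≡a%ℕn+[a/ℕn]*n x d) ⟨
  + c + k * + d - q * + d         ≤⟨ +-monoˡ-≤ (ℤ.- (q * + d)) (+-monoʳ-≤ (+ c) (*-monoʳ-≤-nonNeg (+ d) k≤q)) ⟩
  + c + q * + d - q * + d         ≡⟨ add-sub (+ c) (q * + d) ⟨
  + c                             ∎
  where
  open ≤-Reasoning
  x = + c + k * + d
  q = x /ℕ d

  add-sub : ∀ i j → i ≡ i + j - j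
  add-sub = solve-∀

  k≤q : k ≤ q
  -- From `k * d ≤ x < (q + 1) * d`, cancelling `d` gives `k < q + 1`.
  k≤q = ≤-trans (i<j⇒i≤pred[j] (*-cancelʳ-<-nonNeg {j = ℤ.suc q} (+ d)
          (≤-<-trans (i≤j+i (k * + d) (+ c)) (n<s[n/ℕd]*d x d))))
        (≤-reflexive (pred-suc q))

-- Since `toℕ i < m`, the subtraction in `opposite` is never truncated; the integer form is what the
-- ring solver can handle.
pos-opposite : ∀ {m} (i : Fin m) → + toℕ (opposite i) ≡ + m - 1ℤ - + toℕ i
pos-opposite {m} i = begin
  + toℕ (opposite i)       ≡⟨ cong +_ (opposite-prop i) ⟩
  + (m ∸ suc (toℕ i))      ≡⟨ ⊖-≥ (toℕ<n i) ⟨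
  m ℤ.⊖ suc (toℕ i)        ≡⟨ m-n≡m⊖n m (suc (toℕ i)) ⟨
  + m - (1ℤ + + toℕ i)     ≡⟨ regroup (+ m) (+ toℕ i) ⟩
  + m - 1ℤ - + toℕ i       ∎
  where
  open ≡-Reasoning
  regroup : ∀ i j → i - (1ℤ + j) ≡ i - 1ℤ - j
  regroup = solve-∀

-- The second component of `EdgeLabels`, isolated so that it can be reflected first and the mother
-- edge recovered from it afterwards.
CarryEquation : ∀ {n b} (c₁ c₂ : Fin n) (d₁ d₂ : Fin b) → Set
CarryEquation {n} {b} c₁ c₂ d₁ d₂ =
  + n * + toℕ d₂ - + toℕ d₁ + + toℕ c₁ ≡ + b * + toℕ c₂

-- The constants on the left add up to `n(b-1) - (b-1) + (n-1) = b(n-1)`, so reflection turns each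
-- side of the equation into `b(n-1)` minus itself.
carryEquation-opposite : ∀ {n b} (c₁ c₂ : Fin n) (d₁ d₂ : Fin b) →
  CarryEquation c₁ c₂ d₁ d₂ →
  CarryEquation (opposite c₁) (opposite c₂) (opposite d₁) (opposite d₂)
carryEquation-opposite {n} {b} c₁ c₂ d₁ d₂ eq = begin
  + n * + toℕ (opposite d₂) - + toℕ (opposite d₁) + + toℕ (opposite c₁)
    ≡⟨ cong₂ _+_ (cong₂ _-_ (cong (+ n *_) (pos-opposite d₂)) (pos-opposite d₁)) (pos-opposite c₁) ⟩
  + n * (+ b - 1ℤ - + toℕ d₂) - (+ b - 1ℤ - + toℕ d₁) + (+ n - 1ℤ - + toℕ c₁)
    ≡⟨ reflect (+ n) (+ b) (+ toℕ c₁) (+ toℕ d₁) (+ toℕ d₂) ⟩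
  + b * (+ n - 1ℤ) - (+ n * + toℕ d₂ - + toℕ d₁ + + toℕ c₁)
    ≡⟨ cong (+ b * (+ n - 1ℤ) -_) eq ⟩
  + b * (+ n - 1ℤ) - + b * + toℕ c₂
    ≡⟨ factor (+ b) (+ n - 1ℤ) (+ toℕ c₂) ⟩
  + b * (+ n - 1ℤ - + toℕ c₂)
    ≡⟨ cong (+ b *_) (pos-opposite c₂) ⟨
  + b * + toℕ (opposite c₂) ∎
  where
  open ≡-Reasoning
  reflect : ∀ n b c₁ d₁ d₂ →
    n * (b - 1ℤ - d₂) - (b - 1ℤ - d₁) + (n - 1ℤ - c₁) ≡
    b * (n - 1ℤ) - (n * d₂ - d₁ + c₁)
  reflect = solve-∀

  factor : ∀ i j k → i * j - i * k ≡ i * (j - k)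
  factor = solve-∀

carryEquation⇒motherEdge : ∀ {n b} .{{_ : NonZero b}}
  (c₁ c₂ : Fin n) (d₁ d₂ : Fin b) →
  CarryEquation c₁ c₂ d₁ d₂ → MotherEdge n b d₁ d₂
carryEquation⇒motherEdge {n} {b} c₁ c₂ d₁ d₂ eq = begin
  + ((+ toℕ d₁ + (+ b - + n) * + toℕ d₂) %ℕ b)         ≡⟨ cong (λ i → + (i %ℕ b)) split ⟩
  + ((+ toℕ c₁ + (+ toℕ d₂ - + toℕ c₂) * + b) %ℕ b)    ≤⟨ [c+k*d]%ℕd≤c (toℕ c₁) (+ toℕ d₂ - + toℕ c₂) b ⟩
  + toℕ c₁                                             ≤⟨ i<j⇒i≤pred[j] (+<+ (toℕ<n c₁)) ⟩
  ℤ.pred (+ n)                                         ≡⟨ +-comm (+ n) (ℤ.- 1ℤ) ⟨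
  + n - 1ℤ                                             ∎
  where
  open ≤-Reasoning
  -- Exposes the left side of the carry equation as a block, which `eq` then replaces by `b * c₂`.
  isolate : ∀ n b c₁ d₁ d₂ →
    d₁ + (b - n) * d₂ ≡ c₁ + d₂ * b - (n * d₂ - d₁ + c₁)
  isolate = solve-∀

  collect : ∀ b c₁ c₂ d₂ → c₁ + d₂ * b - b * c₂ ≡ c₁ + (d₂ - c₂) * b
  collect = solve-∀

  split : + toℕ d₁ + (+ b - + n) * + toℕ d₂ ≡ + toℕ c₁ + (+ toℕ d₂ - + toℕ c₂) * + b
  split = trans (isolate (+ n) (+ b) (+ toℕ c₁) (+ toℕ d₁) (+ toℕ d₂))
    (trans (cong (+ toℕ c₁ + + toℕ d₂ * + b -_) eq)
      (collect (+ b) (+ toℕ c₁) (+ toℕ c₂) (+ toℕ d₂)))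

theorem11 : ∀ (n b : ℕ) .{{_ : NonZero b}} → 1 < n → n < b →
    ∀ (c₁ c₂ : Fin n) (d₁ d₂ : Fin b) →
    HoeySloaneEdge n b c₁ c₂ →
    (d₁ , d₂) ∈ EdgeLabels n b c₁ c₂ →
    HoeySloaneEdge n b (opposite c₁) (opposite c₂) ×
    (opposite d₁ , opposite d₂) ∈ EdgeLabels n b (opposite c₁) (opposite c₂)
-- The reflected pair is both the witness that the new label set is nonempty and the label claimed.
theorem11 n b _ _ c₁ c₂ d₁ d₂ _ (_ , eq) = (_ , label) , label
  where
  eq′ : CarryEquation (opposite c₁) (opposite c₂) (opposite d₁) (opposite d₂)
  eq′ = carryEquation-opposite c₁ c₂ d₁ d₂ eq

  label : (opposite d₁ , opposite d₂) ∈ EdgeLabels n b (opposite c₁) (opposite c₂)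
  label = carryEquation⇒motherEdge (opposite c₁) (opposite c₂) (opposite d₁) (opposite d₂) eq′ , eq′
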